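{- Let $X$ be a set of (finite) permutations. If $X$ is labelled well-quasi-ordered (lwqo), then its downward closure $$X^{\le}=\{\sigma : \sigma\le\pi \text{ for some } \pi\in X\}$$ is also lwqo.
   Context: A permutation of length $n$ is an arrangement $\pi=\pi(1)\cdots\pi(n)$ of $1,\dots,n$ (the empty permutation is allowed). The permutation $\sigma$ of length $k$ is contained in $\pi$ of length $n$, written $\sigma\le\pi$, if there are indices $1\le i_1<\cdots<i_k\le n$ such that $\pi(i_1)\cdots\pi(i_k)$ is order isomorphic to $\sigma$ (its terms are in the same relative order as those of $\sigma$). A quasi-order $(Y,\le)$ is well-quasi-ordered (wqo) if every infinite sequence $y_1,y_2,\dots$ in $Y$ has indices $i<j$ with $y_i\le y_j$. Given a quasi-order $(L,\le_L)$, an $L$-labelled permutation is a pair $(\pi,\ell_\pi)$ with $\pi$ a permutation of length $n$ and $\ell_\pi:\{1,\dots,n\}\to L$. We say $(\sigma,\ell_\sigma)\le(\pi,\ell_\pi)$, where $\sigma$ and $\pi$ have lengths $k$ and $n$, if there are indices $1\le i_1<\cdots<i_k\le n$ such that $\pi(i_1)\cdots\pi(i_k)$ is order isomorphic to $\sigma$ and $\ell_\sigma(j)\le_L\ell_\pi(i_j)$ for all $1\le j\le k$. For a set $X$ of permutations, $X\wr L$ is the set of all $L$-labelled members of $X$ under this order. The set $X$ is labelled well-quasi-ordered (lwqo) if $X\wr L$ is wqo for every wqo $(L,\le_L)$. -}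

module Defs where

open import Level using (Level; _⊔_; suc)
open import Data.Nat as ℕ using (ℕ)
open import Data.Fin using (Fin; _<_)
open import Data.Fin.Permutation using (Permutation′; _⟨$⟩ʳ_)
open import Data.Product using (∃-syntax; _×_; _,_)
open import Function using (id; _∘_; _⇔_)
open import Function.Construct.Composition using (_⇔-∘_)
open import Function.Construct.Identity using (⇔-id)
open import Relation.Binary using (Rel; Preorder)
open import Relation.Binary.PropositionalEquality using (_≡_; refl; isEquivalence)
open import Relation.Unary using (Pred; _∈_)

private
  variable
    p c ℓ₁ ℓ₂ : Level
    k m n : ℕ

record Perm : Set where
  constructor mkPerm
  field
    {length} : ℕ
    perm     : Permutation′ length

open Perm public

infix 9 _at_

_at_ : (π : Perm) → Fin (length π) → Fin (length π)
π at i = perm π ⟨$⟩ʳ i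

OrderIsomorphic : (Fin k → Fin m) → (Fin k → Fin n) → Set
OrderIsomorphic u v = ∀ a b → (u a < u b) ⇔ (v a < v b)

-- ι lists the indices i₁ < ⋯ < iₖ of the entries of π forming a copy of σ.
record IsOccurrence (σ π : Perm) (ι : Fin (length σ) → Fin (length π)) : Set where
  field
    increasing : ∀ {a b} → a < b → ι a < ι b
    orderIso   : OrderIsomorphic ((π at_) ∘ ι) (σ at_)

open IsOccurrence public

infix 4 _≼_

_≼_ : Rel Perm _
σ ≼ π = ∃[ ι ] IsOccurrence σ π ι

idOccurrence : ∀ {π} → IsOccurrence π π id
idOccurrence = record
  { increasing = id
  ; orderIso   = λ _ _ → ⇔-id _
  }

∘-occurrence : ∀ {ρ σ π ι κ} → IsOccurrence ρ σ ι → IsOccurrence σ π κ →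
               IsOccurrence ρ π (κ ∘ ι)
∘-occurrence {ι = ι} o q = record
  { increasing = increasing q ∘ increasing o
  ; orderIso   = λ a b → orderIso o a b ⇔-∘ orderIso q (ι a) (ι b)
  }

-- A set of permutations is a predicate.  It need not respect pointwise equality
-- of permutations: pointwise equal permutations contain each other, so only the
-- containment order ever matters.
DownwardClosure : Pred Perm p → Pred Perm p
DownwardClosure X σ = ∃[ π ] (π ∈ X × σ ≼ π)

WQO : Preorder c ℓ₁ ℓ₂ → Set (c ⊔ ℓ₂)
WQO Y = (y : ℕ → Carrier) → ∃[ i ] ∃[ j ] (i ℕ.< j × y i ≲ y j)
  where open Preorder Y using (Carrier; _≲_)

record Labelled (X : Pred Perm p) (L : Set c) : Set (p ⊔ c) where
  constructor labelled
  field
    underlying : Perm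
    member     : underlying ∈ X
    label      : Fin (length underlying) → L

infix 8 _≀_

_≀_ : Pred Perm p → Preorder c ℓ₁ ℓ₂ → Preorder (p ⊔ c) (p ⊔ c) ℓ₂
_≀_ {ℓ₂ = ℓ₂} X L = record
  { Carrier    = Labelled X L.Carrier
  ; _≈_        = _≡_
  ; _≲_        = _⊑_
  ; isPreorder = record
    { isEquivalence = isEquivalence
    ; reflexive     = λ { refl → id , idOccurrence , λ _ → L.refl }
    ; trans         = λ { (ι , o , s) (κ , q , t) →
        κ ∘ ι , ∘-occurrence o q , λ j → L.trans (s j) (t (ι j)) }
    }
  }
  where
  module L = Preorder L
  _⊑_ : Rel (Labelled X L.Carrier) ℓ₂
  labelled σ _ ℓσ ⊑ labelled π _ ℓπ =
    ∃[ ι ] (IsOccurrence σ π ι × (∀ j → ℓσ j L.≲ ℓπ (ι j)))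

-- The level arguments fix the universes of the label sets quantified over.
LWQO : ∀ c ℓ₁ ℓ₂ → Pred Perm p → Set (p ⊔ suc (c ⊔ ℓ₁ ⊔ ℓ₂))
LWQO c ℓ₁ ℓ₂ X = (L : Preorder c ℓ₁ ℓ₂) → WQO L → WQO (X ≀ L)

{-# OPTIONS --safe #-}
module Submission where

-- Label a copy of σ inside π ∈ X by the labels of σ, and the remaining entries of
-- π by a new symbol incomparable to L.  Embeddings of such labelled permutations
-- send the copy of σ₁ into the copy of σ₂, and adding one incomparable element to
-- a wqo leaves it a wqo.

open import Defs
open import Level using (Level; Lift)
open import Data.Empty using (⊥)
open import Data.Fin using (Fin; _<_)
open import Data.Fin.Properties using (any?; _≟_; <-cmp; <-irrefl; <-asym)
open import Data.Maybe using (Maybe; just; nothing; fromMaybe)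
open import Data.Nat as ℕ using (ℕ; _+_; z<s)
open import Data.Nat.Properties using (+-monoˡ-<; m≤n+m)
open import Data.Product using (∃-syntax; _×_; _,_; proj₁; proj₂)
open import Data.Sum using (_⊎_; inj₁; inj₂)
open import Data.Unit using (⊤)
open import Function using (_∘_; _⇔_)
open import Function.Construct.Composition using (_⇔-∘_)
open import Function.Construct.Symmetry using (⇔-sym)
open import Relation.Binary using (Rel; Preorder; tri<; tri≈; tri>)
open import Relation.Binary.PropositionalEquality
  using (_≡_; refl; sym; cong; subst; subst₂)
open import Relation.Nullary using (yes; no; contradiction)
open import Relation.Unary using (Pred)

private
  variable
    a c p r ℓ₁ ℓ₂ : Level
    A : Set a
    m n : ℕ

-- The library's Pointwise lives in a universe that also bounds the carrier, whereas
-- LWQO quantifies over orders valued exactly in ℓ₂.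
MaybeRel : Rel A r → Rel (Maybe A) r
MaybeRel {r = r} R nothing  nothing  = Lift r ⊤
MaybeRel {r = r} R nothing  (just _) = Lift r ⊥
MaybeRel {r = r} R (just _) nothing  = Lift r ⊥
MaybeRel         R (just x) (just y) = R x y

withIncomparable : Preorder c ℓ₁ ℓ₂ → Preorder c ℓ₁ ℓ₂
withIncomparable L = record
  { Carrier    = Maybe L.Carrier
  ; _≈_        = MaybeRel L._≈_
  ; _≲_        = MaybeRel L._≲_
  ; isPreorder = record
    { isEquivalence = record
      { refl  = λ { {nothing} → _ ; {just _} → L.Eq.refl }
      ; sym   = λ { {nothing} {nothing} _ → _ ; {just _} {just _} p → L.Eq.sym p }
      ; trans = λ { {nothing} {nothing} {nothing} _ _ → _
                  ; {just _} {just _} {just _} p q → L.Eq.trans p q }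
      }
    ; reflexive = λ { {nothing} {nothing} _ → _ ; {just _} {just _} p → L.reflexive p }
    ; trans     = λ { {nothing} {nothing} {nothing} _ _ → _
                    ; {just _} {just _} {just _} p q → L.trans p q }
    }
  }
  where module L = Preorder L

module _ (L : Preorder c ℓ₁ ℓ₂) (wqo : WQO L) where
  private
    module L = Preorder L
    module M = Preorder (withIncomparable L)

  GoodPair : (ℕ → M.Carrier) → Set ℓ₂
  GoodPair y = ∃[ i ] ∃[ j ] (i ℕ.< j × y i M.≲ y j)

  goodPair-nothings : ∀ y {i j} → i ℕ.< j → y i ≡ nothing → y j ≡ nothing → GoodPair y
  goodPair-nothings y i<j p q = _ , _ , i<j , subst₂ M._≲_ (sym p) (sym q) _

  goodPair-shift : ∀ y s → GoodPair (y ∘ (_+ s)) → GoodPair y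
  goodPair-shift y s (i , j , i<j , p) = i + s , j + s , +-monoˡ-< s i<j , p

  -- The default label d replaces nothing so that the wqo of L applies; a pair in
  -- which the default was used locates an occurrence of nothing.
  goodPair-or-nothing : ∀ y → L.Carrier → GoodPair y ⊎ ∃[ i ] y i ≡ nothing
  goodPair-or-nothing y d with wqo (fromMaybe d ∘ y)
  ... | i , j , i<j , p with y i in eqᵢ | y j in eqⱼ
  ...   | nothing | _       = inj₂ (i , eqᵢ)
  ...   | just _  | nothing = inj₂ (j , eqⱼ)
  ...   | just _  | just _  = inj₁ (i , j , i<j , subst₂ M._≲_ (sym eqᵢ) (sym eqⱼ) p)

  -- Any later `nothing` pairs with the one at index 0, so it is enough to find either such an index
  -- or a good pair further on.
  goodPair-nothing-first : ∀ y → y 0 ≡ nothing → GoodPair y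
  goodPair-nothing-first y eq₀ with y 1 in eq₁
  ... | nothing = goodPair-nothings y z<s eq₀ eq₁
  -- The label at index 1 serves as the default. Dropping index 0 ensures that a `nothing` found
  -- here is a second one.
  ... | just d with goodPair-or-nothing (y ∘ (_+ 1)) d
  ...   | inj₁ good      = goodPair-shift y 1 good
  ...   | inj₂ (i , eqᵢ) =
    goodPair-nothings y (m≤n+m 1 i) eq₀ eqᵢ

  -- Two occurrences of `nothing` already form a good pair, so how often it occurs is never decided:
  -- once one is found, the sequence is shifted to start there.
  withIncomparable-wqo : WQO (withIncomparable L)
  withIncomparable-wqo y with y 0 in eq₀
  ... | nothing = goodPair-nothing-first y eq₀
  ... | just d with goodPair-or-nothing y d
  ...   | inj₁ good      = good
  ...   | inj₂ (i , eqᵢ) = goodPair-shift y i (goodPair-nothing-first (y ∘ (_+ i)) eqᵢ)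

StrictlyIncreasing : (Fin m → Fin n) → Set
StrictlyIncreasing ι = ∀ {a b} → a < b → ι a < ι b

module _ {ι : Fin m → Fin n} (ι-mono : StrictlyIncreasing ι) where

  increasing⇒injective : ∀ {a b} → ι a ≡ ι b → a ≡ b
  increasing⇒injective {a} {b} eq with <-cmp a b
  ... | tri< a<b _ _ = contradiction (ι-mono a<b) (<-irrefl eq)
  ... | tri≈ _ a≡b _ = a≡b
  ... | tri> _ _ b<a = contradiction (ι-mono b<a) (<-irrefl (sym eq))

  increasing⇒reflects-< : ∀ {a b} → ι a < ι b → a < b
  increasing⇒reflects-< {a} {b} ιa<ιb with <-cmp a b
  ... | tri< a<b _ _  = a<b
  ... | tri≈ _ refl _ = contradiction ιa<ιb (<-irrefl refl)
  ... | tri> _ _ b<a  = contradiction ιa<ιb (<-asym (ι-mono b<a))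

extendLabel : (Fin m → Fin n) → (Fin m → A) → Fin n → Maybe A
extendLabel ι ℓ i with any? (λ a → ι a ≟ i)
... | yes (a , _) = just (ℓ a)
... | no  _       = nothing

extendLabel-image : {ι : Fin m → Fin n} → StrictlyIncreasing ι →
                    (ℓ : Fin m → A) → ∀ a → extendLabel ι ℓ (ι a) ≡ just (ℓ a)
extendLabel-image {ι = ι} ι-mono ℓ a with any? (λ b → ι b ≟ ι a)
-- The search need not return `a` itself; injectivity of `ι` identifies the index found with `a`.
... | yes (_ , eq) = cong (just ∘ ℓ) (increasing⇒injective ι-mono eq)
... | no  none     = contradiction (a , refl) none

-- No `just` lies below `nothing`, so the `no` case is empty and `i` lies in the image of `ι`. This
-- is what confines an embedding to the marked copy.
extendLabel-above-just : (R : Rel A r) (ι : Fin m → Fin n) (ℓ : Fin m → A) →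
                         ∀ {x} i → MaybeRel R (just x) (extendLabel ι ℓ i) →
                         ∃[ b ] (ι b ≡ i × R x (ℓ b))
extendLabel-above-just R ι ℓ i x≲ with any? (λ a → ι a ≟ i)
... | yes (b , eq) = b , eq , x≲

liftLabelled : {X : Pred Perm p} {A : Set a} →
               Labelled (DownwardClosure X) A → Labelled X (Maybe A)
liftLabelled (labelled σ (π , π∈X , ι , o) ℓ) = labelled π π∈X (extendLabel ι ℓ)

-- Since `κ` reflects `<`, `β` inherits monotonicity from `ι`. The values of `σ` at `a` and of `τ`
-- at `β a` both compare as those of `π` at `ι a`.
factor-occurrence : ∀ {σ τ π ι κ β} → IsOccurrence σ π ι → IsOccurrence τ π κ →
                    (∀ a → κ (β a) ≡ ι a) → IsOccurrence σ τ β
factor-occurrence {σ} {τ} {π} {ι} {κ} {β} o q eq = record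
  { increasing = λ {a} {b} a<b → increasing⇒reflects-< (increasing q)
      (subst₂ _<_ (sym (eq a)) (sym (eq b)) (increasing o a<b))
  ; orderIso   = λ a b →
      subst₂ (λ i j → (π at i < π at j) ⇔ (σ at a < σ at b))
        (sym (eq a)) (sym (eq b)) (orderIso o a b)
      ⇔-∘ ⇔-sym (orderIso q (β a) (β b))
  }

-- The occurrence `ε ∘ ι` of `σ` lands in the image of `κ` by `match`, so it factors through `κ` as
-- an occurrence of `σ` in `τ`.
liftLabelled-reflects : (X : Pred Perm p) (L : Preorder c ℓ₁ ℓ₂) →
  let module D = Preorder (DownwardClosure X ≀ L)
      module U = Preorder (X ≀ withIncomparable L)
  in ∀ x y → liftLabelled x U.≲ liftLabelled y → x D.≲ y
liftLabelled-reflects X L (labelled σ (_ , _ , ι , o) ℓσ) (labelled τ (_ , _ , κ , q) ℓτ)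
  (ε , e , label≲) =
  proj₁ ∘ match , factor-occurrence (∘-occurrence o e) q (proj₁ ∘ proj₂ ∘ match) ,
  proj₂ ∘ proj₂ ∘ match
  where
  open Preorder L using (_≲_)
  match : ∀ a → ∃[ b ] (κ b ≡ ε (ι a) × ℓσ a ≲ ℓτ b)
  -- The entry `ι a` carries `just (ℓσ a)`, which bounds the label of its image under `ε` from
  -- below.
  match a = extendLabel-above-just _≲_ κ ℓτ (ε (ι a))
    (subst (λ x → MaybeRel _≲_ x (extendLabel κ ℓτ (ε (ι a))))
      (extendLabel-image (increasing o) ℓσ a) (label≲ (ι a)))

theorem3p2 : ∀ {p c ℓ₁ ℓ₂} (X : Pred Perm p) → LWQO c ℓ₁ ℓ₂ X → LWQO c ℓ₁ ℓ₂ (DownwardClosure X)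
theorem3p2 X lwqo L wqo x
  -- `withIncomparable` keeps the universe levels of `L`, so `lwqo` applies to it; an
  -- order-reflecting map pulls good pairs back.
  with i , j , i<j , p ← lwqo (withIncomparable L) (withIncomparable-wqo L wqo) (liftLabelled ∘ x)
  = i , j , i<j , liftLabelled-reflects X L (x i) (x j) p
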